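{- Let $\beta$ be a parameter and consider the map $\varphi:(x_0,x_1,x_2,x_3)\mapsto(x_1,x_2,x_3,(x_1x_3+\beta)/x_0)$, i.e. the recurrence \[x_{n+2}\,x_{n-2}=x_{n+1}\,x_{n-1}+\beta.\] Define \[\mathcal{Q}_0=\frac{x_0+x_2}{x_1},\qquad \mathcal{Q}_1=\frac{x_1+x_3}{x_2},\qquad \mathcal{Q}_2=\frac{x_1}{x_0}+\frac{x_2}{x_3}+\frac{\beta}{x_0x_3},\] and \[\tilde{\mathcal{J}}_1=\mathcal{Q}_0\mathcal{Q}_1\mathcal{Q}_2-\mathcal{Q}_0-\mathcal{Q}_1-\mathcal{Q}_2,\quad \tilde{\mathcal{J}}_2=\mathcal{Q}_0\mathcal{Q}_1+\mathcal{Q}_1\mathcal{Q}_2+\mathcal{Q}_2\mathcal{Q}_0-3,\quad \tilde{\mathcal{J}}_3=\mathcal{Q}_0\mathcal{Q}_1\mathcal{Q}_2.\] Then $\varphi$ is superintegrable: $\tilde{\mathcal{J}}_1,\tilde{\mathcal{J}}_2,\tilde{\mathcal{J}}_3$ are three independent conserved quantities of $\varphi$, satisfying $\{\tilde{\mathcal{J}}_1,\tilde{\mathcal{J}}_2\}_0=0=\{\tilde{\mathcal{J}}_1,\tilde{\mathcal{J}}_3\}_0$, and also $\{\tilde{\mathcal{J}}_1,\mathcal{Q}_j\}_0=0$ for $j=0,1,2$. The iterates of the recurrence satisfy the sixth-order linear recurrence \[x_{n+6}-\tilde{\mathcal{J}}_1\,x_{n+3}+x_n=0,\] and the solution of the initial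 value problem is \[x_{3n+j}=\tilde{\mathcal{A}}_j\,T_n(\tilde{\mathcal{J}}_1/2)+\tilde{\mathcal{B}}_j\,U_n(\tilde{\mathcal{J}}_1/2),\qquad j=0,1,2,\] where $T_n,U_n$ are the Chebyshev polynomials of the first and second kind and \[\tilde{\mathcal{A}}_j=2x_j-\frac{2x_{j+3}}{\tilde{\mathcal{J}}_1},\qquad \tilde{\mathcal{B}}_j=-x_j+\frac{2x_{j+3}}{\tilde{\mathcal{J}}_1},\qquad j=0,1,2.\]
   Context: $\{\cdot,\cdot\}_0$ is the log-canonical Poisson bracket on rational functions of $x_0,\ldots,x_3$ defined by $\{x_0,x_1\}_0=x_0x_1$, $\{x_0,x_2\}_0=0$, $\{x_0,x_3\}_0=x_0x_3$, $\{x_1,x_2\}_0=x_1x_2$, $\{x_1,x_3\}_0=0$, $\{x_2,x_3\}_0=x_2x_3$ (extended by antisymmetry, bilinearity and Leibniz rule); $\varphi$ preserves this bracket. In the solution formula, $\tilde{\mathcal{J}}_1$ is evaluated at the initial data $(x_0,x_1,x_2,x_3)$, and $x_4,x_5$ denote the iterates given by the recurrence. -}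

module Defs where

open import Data.Nat using (ℕ; zero; suc)
open import Data.Fin using (Fin; zero; suc)
open import Data.Integer using (+_)
open import Data.Rational using (ℚ; 0ℚ; 1ℚ; _+_; _*_; _-_; -_; 1/_; _/_; ≢-nonZero)
open import Data.Rational.Properties using (_≟_)
open import Relation.Nullary using (yes; no)
import Data.Fin as F

-- Total inverse on ℚ (agrees with 1/q whenever q ≢ 0; 0 otherwise).
-- Every use below is guarded by hypotheses making the argument nonzero.

inv : ℚ → ℚ
inv q with q ≟ 0ℚ
... | yes _ = 0ℚ
... | no q≢0 = 1/_ q {{≢-nonZero q≢0}}

Pt : Set
Pt = Fin 4 → ℚ

sum4 : (Fin 4 → ℚ) → ℚ
sum4 f = f zero + (f (suc zero) + (f (suc (suc zero)) + f (suc (suc (suc zero)))))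

sum3 : (Fin 3 → ℚ) → ℚ
sum3 f = f zero + (f (suc zero) + f (suc (suc zero)))

infixl 6 _⊕_ _⊖_
infixl 7 _⊗_

data Expr : Set where
  X   : Fin 4 → Expr
  K   : ℚ → Expr
  _⊕_ : Expr → Expr → Expr
  _⊗_ : Expr → Expr → Expr
  neg : Expr → Expr
  rec : Expr → Expr

_⊖_ : Expr → Expr → Expr
e ⊖ f = e ⊕ neg f

eval : Pt → Expr → ℚ
eval p (X i)   = p i
eval p (K c)   = c
eval p (e ⊕ f) = eval p e + eval p f
eval p (e ⊗ f) = eval p e * eval p f
eval p (neg e) = - eval p e
eval p (rec e) = inv (eval p e)

∂ : Fin 4 → Expr → Expr
∂ i (X j) with i F.≟ j
... | yes _ = K 1ℚ
... | no _  = K 0ℚ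
∂ i (K c)   = K 0ℚ
∂ i (e ⊕ f) = ∂ i e ⊕ ∂ i f
∂ i (e ⊗ f) = ∂ i e ⊗ f ⊕ e ⊗ ∂ i f
∂ i (neg e) = neg (∂ i e)
∂ i (rec e) = neg (∂ i e ⊗ rec (e ⊗ e))

-- The log-canonical Poisson bracket {·,·}₀ :
-- {xᵢ,xⱼ}₀ = ω i j · xᵢ xⱼ,  {f,g}₀ = Σᵢⱼ {xᵢ,xⱼ}₀ ∂ᵢf ∂ⱼg

ω : Fin 4 → Fin 4 → ℚ
ω zero (suc zero) = 1ℚ
ω zero (suc (suc (suc zero))) = 1ℚ
ω (suc zero) (suc (suc zero)) = 1ℚ
ω (suc (suc zero)) (suc (suc (suc zero))) = 1ℚ
ω (suc zero) zero = - 1ℚ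
ω (suc (suc (suc zero))) zero = - 1ℚ
ω (suc (suc zero)) (suc zero) = - 1ℚ
ω (suc (suc (suc zero))) (suc (suc zero)) = - 1ℚ
ω _ _ = 0ℚ

pb₀ : Expr → Expr → Pt → ℚ
pb₀ f g p = sum4 λ i → sum4 λ j →
  ω i j * p i * p j * eval p (∂ i f) * eval p (∂ j g)

x₀ x₁ x₂ x₃ : Expr
x₀ = X zero
x₁ = X (suc zero)
x₂ = X (suc (suc zero))
x₃ = X (suc (suc (suc zero)))

φ : ℚ → Pt → Pt
φ β p zero = p (suc zero)
φ β p (suc zero) = p (suc (suc zero))
φ β p (suc (suc zero)) = p (suc (suc (suc zero)))
φ β p (suc (suc (suc zero))) =
  (p (suc zero) * p (suc (suc (suc zero))) + β) * inv (p zero)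

Q₀ Q₁ : Expr
Q₀ = (x₀ ⊕ x₂) ⊗ rec x₁
Q₁ = (x₁ ⊕ x₃) ⊗ rec x₂

Q₂ : ℚ → Expr
Q₂ β = x₁ ⊗ rec x₀ ⊕ x₂ ⊗ rec x₃ ⊕ K β ⊗ rec (x₀ ⊗ x₃)

Q : ℚ → Fin 3 → Expr
Q β zero = Q₀
Q β (suc zero) = Q₁
Q β (suc (suc zero)) = Q₂ β

J̃₁ J̃₂ J̃₃ : ℚ → Expr
J̃₁ β = Q₀ ⊗ Q₁ ⊗ Q₂ β ⊖ Q₀ ⊖ Q₁ ⊖ Q₂ β
J̃₂ β = Q₀ ⊗ Q₁ ⊕ Q₁ ⊗ Q₂ β ⊕ Q₂ β ⊗ Q₀ ⊖ K (+ 3 / 1)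
J̃₃ β = Q₀ ⊗ Q₁ ⊗ Q₂ β

J̃ : ℚ → Fin 3 → Expr
J̃ β zero = J̃₁ β
J̃ β (suc zero) = J̃₂ β
J̃ β (suc (suc zero)) = J̃₃ β

seq : ℚ → Pt → ℕ → ℚ
seq β p 0 = p zero
seq β p 1 = p (suc zero)
seq β p 2 = p (suc (suc zero))
seq β p 3 = p (suc (suc (suc zero)))
seq β p (suc (suc (suc (suc n)))) =
  (seq β p (suc n) * seq β p (suc (suc (suc n))) + β) * inv (seq β p n)

T : ℕ → ℚ → ℚ
T 0 t = 1ℚ
T 1 t = t
T (suc (suc n)) t = (+ 2 / 1) * t * T (suc n) t - T n t

U : ℕ → ℚ → ℚ
U 0 t = 1ℚ
U 1 t = (+ 2 / 1) * t
U (suc (suc n)) t = (+ 2 / 1) * t * U (suc n) t - U n t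

-- φ rotates the three quantities, Q₀ ∘ φ = Q₁, Q₁ ∘ φ = Q₂, Q₂ ∘ φ = Q₀, and the J̃ₖ are
-- symmetric in them, so they are conserved.  In logarithmic coordinates the brackets of the
-- Qₗ close quadratically, {Qₗ, Qₗ₊₁}₀ = 2 (Qₗ Qₗ₊₁ − 1), and J̃₁ is a Casimir of that table;
-- by the chain rule J̃₁ then commutes with every function of the Qₗ.  Independence: ∇J̃ is
-- (∂J̃/∂Q) ∇Q, and det (∂J̃/∂Q) is the Vandermonde determinant of the Qₗ, so it suffices to
-- exhibit a point with distinct Qₗ and independent ∇Qₗ.  Along an orbit xₙ₊₂ = aₙ xₙ₊₁ − xₙ
-- with aₙ = Q₀(xₙ, …, xₙ₊₃) three-periodic; the transfer matrix over one period has
-- determinant 1 and trace J̃₁, so Cayley–Hamilton gives xₙ₊₆ − J̃₁ xₙ₊₃ + xₙ = 0, and every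
-- third iterate solves the Chebyshev recurrence at J̃₁/2.

module Submission where

open import Defs
open import Data.Nat using (ℕ; zero; suc)
import Data.Nat as ℕ
open import Data.Nat.Tactic.RingSolver as ℕ-Solver using ()
open import Data.Fin using (Fin; toℕ)
open import Data.Fin.Patterns using (0F; 1F; 2F; 3F)
open import Data.Integer using (+_)
open import Data.Rational using (ℚ; 0ℚ; 1ℚ; _+_; _*_; _-_; -_; _/_; ≢-nonZero)
open import Data.Rational.Properties
  using (_≟_; +-*-commutativeRing; *-inverseʳ; *-zeroˡ; *-zeroʳ; *-identityˡ; *-identityʳ; *-assoc;
         neg-injective)
open import Data.Product using (_×_; _,_; ∃)
open import Relation.Nullary using (Dec; yes; no; contradiction)
open import Relation.Nullary.Decidable.Core using (dec⇒maybe)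
open import Relation.Binary.PropositionalEquality
  using (_≡_; _≢_; refl; sym; trans; cong; cong₂; subst; module ≡-Reasoning)
open import Tactic.RingSolver.Core.AlmostCommutativeRing using (AlmostCommutativeRing; fromCommutativeRing)
open import Tactic.RingSolver using (solve-∀)

open ≡-Reasoning

ℚ-ring : AlmostCommutativeRing _ _
ℚ-ring = fromCommutativeRing +-*-commutativeRing (λ x → dec⇒maybe (0ℚ ≟ x))

cong₃ : ∀ {A B C D : Set} (f : A → B → C → D) {a a′ b b′ c c′} →
        a ≡ a′ → b ≡ b′ → c ≡ c′ → f a b c ≡ f a′ b′ c′
cong₃ f refl refl refl = refl

1≢0 : 1ℚ ≢ 0ℚ
1≢0 ()

*-inv : ∀ {x} → x ≢ 0ℚ → x * inv x ≡ 1ℚ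
*-inv {x} x≢0 with x ≟ 0ℚ
... | yes x≡0 = contradiction x≡0 x≢0
... | no x≢0′ = *-inverseʳ x {{≢-nonZero x≢0′}}

inv-≢0 : ∀ {x} → x ≢ 0ℚ → inv x ≢ 0ℚ
inv-≢0 {x} x≢0 inv≡0 = 1≢0 (begin
  1ℚ          ≡⟨ sym (*-inv x≢0) ⟩
  x * inv x   ≡⟨ cong (x *_) inv≡0 ⟩
  x * 0ℚ      ≡⟨ *-zeroʳ x ⟩
  0ℚ          ∎)

*-≢0 : ∀ {x y} → x ≢ 0ℚ → y ≢ 0ℚ → x * y ≢ 0ℚ
*-≢0 {x} {y} x≢0 y≢0 xy≡0 = x≢0 (begin
  x                  ≡⟨ sym (*-identityʳ x) ⟩
  x * 1ℚ             ≡⟨ cong (x *_) (sym (*-inv y≢0)) ⟩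
  x * (y * inv y)    ≡⟨ sym (*-assoc x y (inv y)) ⟩
  x * y * inv y      ≡⟨ cong (_* inv y) xy≡0 ⟩
  0ℚ * inv y         ≡⟨ *-zeroˡ (inv y) ⟩
  0ℚ                 ∎)

neg-≢0 : ∀ {x} → x ≢ 0ℚ → - x ≢ 0ℚ
neg-≢0 x≢0 -x≡0 = x≢0 (neg-injective -x≡0)

factor-≢0 : ∀ {x y z} → x * y ≡ z → z ≢ 0ℚ → x ≢ 0ℚ
factor-≢0 {y = y} xy≡z z≢0 refl = z≢0 (trans (sym xy≡z) (*-zeroˡ y))

zero-product : ∀ {x y} → x * y ≡ 0ℚ → y ≢ 0ℚ → x ≡ 0ℚ
zero-product {x} xy≡0 y≢0 with x ≟ 0ℚ
... | yes x≡0 = x≡0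
... | no x≢0 = contradiction xy≡0 (*-≢0 x≢0 y≢0)

-- The junk value inv 0ℚ = 0ℚ makes this hold without side conditions.
inv-* : ∀ x y → inv (x * y) ≡ inv x * inv y
inv-* x y = by-cases (x ≟ 0ℚ) (y ≟ 0ℚ)
  where
  by-cases : Dec (x ≡ 0ℚ) → Dec (y ≡ 0ℚ) → inv (x * y) ≡ inv x * inv y
  by-cases (yes refl) _ = trans (cong inv (*-zeroˡ y)) (sym (*-zeroˡ (inv y)))
  by-cases (no _) (yes refl) = trans (cong inv (*-zeroʳ x)) (sym (*-zeroʳ (inv x)))
  by-cases (no x≢0) (no y≢0) = begin
    inv (x * y)                                ≡⟨ pad (inv (x * y)) ⟩
    inv (x * y) * 1ℚ * 1ℚ
      ≡⟨ cong₂ (λ u v → inv (x * y) * u * v) (sym (*-inv x≢0)) (sym (*-inv y≢0)) ⟩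
    inv (x * y) * (x * inv x) * (y * inv y)    ≡⟨ regroup (inv (x * y)) x (inv x) y (inv y) ⟩
    x * y * inv (x * y) * (inv x * inv y)      ≡⟨ cong (_* (inv x * inv y)) (*-inv (*-≢0 x≢0 y≢0)) ⟩
    1ℚ * (inv x * inv y)                       ≡⟨ *-identityˡ _ ⟩
    inv x * inv y                              ∎
    where
    pad : ∀ a → a ≡ a * 1ℚ * 1ℚ
    pad = solve-∀ ℚ-ring
    regroup : ∀ a x ι y κ → a * (x * ι) * (y * κ) ≡ x * y * a * (ι * κ)
    regroup = solve-∀ ℚ-ring

-- Identities between rational functions are ring identities modulo relations r = s
-- (x * inv x = 1, inv (x * y) = inv x * inv y); each relation is removed by exhibiting its multiple.
modulo : ∀ {a b r s} c → r ≡ s → a ≡ b + c * (r - s) → a ≡ b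
modulo {b = b} {s = s} c refl a≡ = trans a≡ (vanish b c s)
  where
  vanish : ∀ b c s → b + c * (s - s) ≡ b
  vanish = solve-∀ ℚ-ring

difference-zero : ∀ {a b} → a - b ≡ 0ℚ → a ≡ b
difference-zero {a} {b} a-b≡0 = modulo 1ℚ a-b≡0 (identity a b)
  where
  identity : ∀ a b → a ≡ b + 1ℚ * (a - b - 0ℚ)
  identity = solve-∀ ℚ-ring

sum3-cong : ∀ {f g : Fin 3 → ℚ} → (∀ i → f i ≡ g i) → sum3 f ≡ sum3 g
sum3-cong f≡g = cong₂ _+_ (f≡g 0F) (cong₂ _+_ (f≡g 1F) (f≡g 2F))

sum4-cong : ∀ {f g : Fin 4 → ℚ} → (∀ i → f i ≡ g i) → sum4 f ≡ sum4 g
sum4-cong f≡g = cong₂ _+_ (f≡g 0F) (cong₂ _+_ (f≡g 1F) (cong₂ _+_ (f≡g 2F) (f≡g 3F)))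

sum4-scale : ∀ a (f : Fin 4 → ℚ) → sum4 (λ i → a * f i) ≡ a * sum4 f
sum4-scale a f = distribute a (f 0F) (f 1F) (f 2F) (f 3F)
  where
  distribute : ∀ a f₀ f₁ f₂ f₃ → a * f₀ + (a * f₁ + (a * f₂ + a * f₃)) ≡ a * (f₀ + (f₁ + (f₂ + f₃)))
  distribute = solve-∀ ℚ-ring

sum4-sum3 : ∀ (f : Fin 3 → Fin 4 → ℚ) → sum4 (λ i → sum3 (λ l → f l i)) ≡ sum3 (λ l → sum4 (f l))
sum4-sum3 f = swap (f 0F 0F) (f 0F 1F) (f 0F 2F) (f 0F 3F) (f 1F 0F) (f 1F 1F) (f 1F 2F) (f 1F 3F)
                   (f 2F 0F) (f 2F 1F) (f 2F 2F) (f 2F 3F)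
  where
  swap : ∀ a₀ a₁ a₂ a₃ b₀ b₁ b₂ b₃ c₀ c₁ c₂ c₃ →
    (a₀ + (b₀ + c₀)) + ((a₁ + (b₁ + c₁)) + ((a₂ + (b₂ + c₂)) + (a₃ + (b₃ + c₃))))
      ≡ (a₀ + (a₁ + (a₂ + a₃))) + ((b₀ + (b₁ + (b₂ + b₃))) + (c₀ + (c₁ + (c₂ + c₃))))
  swap = solve-∀ ℚ-ring

vecMat-assoc : ∀ (c : Fin 3 → ℚ) (M : Fin 3 → Fin 3 → ℚ) (g : Fin 3 → ℚ) →
  sum3 (λ k → c k * sum3 (λ l → M k l * g l)) ≡ sum3 (λ l → sum3 (λ k → c k * M k l) * g l)
vecMat-assoc c M g = assoc (c 0F) (c 1F) (c 2F) (M 0F 0F) (M 0F 1F) (M 0F 2F) (M 1F 0F) (M 1F 1F) (M 1F 2F)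
                           (M 2F 0F) (M 2F 1F) (M 2F 2F) (g 0F) (g 1F) (g 2F)
  where
  assoc : ∀ c₀ c₁ c₂ m₀₀ m₀₁ m₀₂ m₁₀ m₁₁ m₁₂ m₂₀ m₂₁ m₂₂ g₀ g₁ g₂ →
      c₀ * (m₀₀ * g₀ + (m₀₁ * g₁ + m₀₂ * g₂))
    + (c₁ * (m₁₀ * g₀ + (m₁₁ * g₁ + m₁₂ * g₂)) + c₂ * (m₂₀ * g₀ + (m₂₁ * g₁ + m₂₂ * g₂)))
    ≡ (c₀ * m₀₀ + (c₁ * m₁₀ + c₂ * m₂₀)) * g₀
    + ((c₀ * m₀₁ + (c₁ * m₁₁ + c₂ * m₂₁)) * g₁ + (c₀ * m₀₂ + (c₁ * m₁₂ + c₂ * m₂₂)) * g₂)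
  assoc = solve-∀ ℚ-ring

det3 : (Fin 3 → Fin 3 → ℚ) → ℚ
det3 A = A 0F 0F * (A 1F 1F * A 2F 2F - A 1F 2F * A 2F 1F)
       - A 0F 1F * (A 1F 0F * A 2F 2F - A 1F 2F * A 2F 0F)
       + A 0F 2F * (A 1F 0F * A 2F 1F - A 1F 1F * A 2F 0F)

cofactor : (Fin 3 → Fin 3 → ℚ) → Fin 3 → Fin 3 → ℚ
cofactor A 0F 0F = A 1F 1F * A 2F 2F - A 1F 2F * A 2F 1F
cofactor A 0F 1F = - (A 1F 0F * A 2F 2F - A 1F 2F * A 2F 0F)
cofactor A 0F 2F = A 1F 0F * A 2F 1F - A 1F 1F * A 2F 0F
cofactor A 1F 0F = - (A 0F 1F * A 2F 2F - A 0F 2F * A 2F 1F)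
cofactor A 1F 1F = A 0F 0F * A 2F 2F - A 0F 2F * A 2F 0F
cofactor A 1F 2F = - (A 0F 0F * A 2F 1F - A 0F 1F * A 2F 0F)
cofactor A 2F 0F = A 0F 1F * A 1F 2F - A 0F 2F * A 1F 1F
cofactor A 2F 1F = - (A 0F 0F * A 1F 2F - A 0F 2F * A 1F 0F)
cofactor A 2F 2F = A 0F 0F * A 1F 1F - A 0F 1F * A 1F 0F

laplace : ∀ A (c : Fin 3 → ℚ) i → c i * det3 A ≡ sum3 (λ j → sum3 (λ k → c k * A k j) * cofactor A i j)
laplace A c 0F = expansion (c 0F) (c 1F) (c 2F)
  (A 0F 0F) (A 0F 1F) (A 0F 2F) (A 1F 0F) (A 1F 1F) (A 1F 2F) (A 2F 0F) (A 2F 1F) (A 2F 2F)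
  where
  expansion : ∀ c₀ c₁ c₂ a₀₀ a₀₁ a₀₂ a₁₀ a₁₁ a₁₂ a₂₀ a₂₁ a₂₂ →
    let v₀ = c₀ * a₀₀ + (c₁ * a₁₀ + c₂ * a₂₀)
        v₁ = c₀ * a₀₁ + (c₁ * a₁₁ + c₂ * a₂₁)
        v₂ = c₀ * a₀₂ + (c₁ * a₁₂ + c₂ * a₂₂)
    in c₀ * (a₀₀ * (a₁₁ * a₂₂ - a₁₂ * a₂₁) - a₀₁ * (a₁₀ * a₂₂ - a₁₂ * a₂₀) + a₀₂ * (a₁₀ * a₂₁ - a₁₁ * a₂₀))
       ≡ v₀ * (a₁₁ * a₂₂ - a₁₂ * a₂₁) + (v₁ * - (a₁₀ * a₂₂ - a₁₂ * a₂₀) + v₂ * (a₁₀ * a₂₁ - a₁₁ * a₂₀))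
  expansion = solve-∀ ℚ-ring
laplace A c 1F = expansion (c 0F) (c 1F) (c 2F)
  (A 0F 0F) (A 0F 1F) (A 0F 2F) (A 1F 0F) (A 1F 1F) (A 1F 2F) (A 2F 0F) (A 2F 1F) (A 2F 2F)
  where
  expansion : ∀ c₀ c₁ c₂ a₀₀ a₀₁ a₀₂ a₁₀ a₁₁ a₁₂ a₂₀ a₂₁ a₂₂ →
    let v₀ = c₀ * a₀₀ + (c₁ * a₁₀ + c₂ * a₂₀)
        v₁ = c₀ * a₀₁ + (c₁ * a₁₁ + c₂ * a₂₁)
        v₂ = c₀ * a₀₂ + (c₁ * a₁₂ + c₂ * a₂₂)
    in c₁ * (a₀₀ * (a₁₁ * a₂₂ - a₁₂ * a₂₁) - a₀₁ * (a₁₀ * a₂₂ - a₁₂ * a₂₀) + a₀₂ * (a₁₀ * a₂₁ - a₁₁ * a₂₀))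
       ≡ v₀ * - (a₀₁ * a₂₂ - a₀₂ * a₂₁) + (v₁ * (a₀₀ * a₂₂ - a₀₂ * a₂₀) + v₂ * - (a₀₀ * a₂₁ - a₀₁ * a₂₀))
  expansion = solve-∀ ℚ-ring
laplace A c 2F = expansion (c 0F) (c 1F) (c 2F)
  (A 0F 0F) (A 0F 1F) (A 0F 2F) (A 1F 0F) (A 1F 1F) (A 1F 2F) (A 2F 0F) (A 2F 1F) (A 2F 2F)
  where
  expansion : ∀ c₀ c₁ c₂ a₀₀ a₀₁ a₀₂ a₁₀ a₁₁ a₁₂ a₂₀ a₂₁ a₂₂ →
    let v₀ = c₀ * a₀₀ + (c₁ * a₁₀ + c₂ * a₂₀)
        v₁ = c₀ * a₀₁ + (c₁ * a₁₁ + c₂ * a₂₁)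
        v₂ = c₀ * a₀₂ + (c₁ * a₁₂ + c₂ * a₂₂)
    in c₂ * (a₀₀ * (a₁₁ * a₂₂ - a₁₂ * a₂₁) - a₀₁ * (a₁₀ * a₂₂ - a₁₂ * a₂₀) + a₀₂ * (a₁₀ * a₂₁ - a₁₁ * a₂₀))
       ≡ v₀ * (a₀₁ * a₁₂ - a₀₂ * a₁₁) + (v₁ * - (a₀₀ * a₁₂ - a₀₂ * a₁₀) + v₂ * (a₀₀ * a₁₁ - a₀₁ * a₁₀))
  expansion = solve-∀ ℚ-ring

cramer : ∀ A (c : Fin 3 → ℚ) → det3 A ≢ 0ℚ → (∀ j → sum3 (λ k → c k * A k j) ≡ 0ℚ) → ∀ i → c i ≡ 0ℚ
cramer A c det≢0 cA≡0 i = zero-product (begin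
  c i * det3 A                                                 ≡⟨ laplace A c i ⟩
  sum3 (λ j → sum3 (λ k → c k * A k j) * cofactor A i j)       ≡⟨ sum3-cong (λ j → cong (_* cofactor A i j) (cA≡0 j)) ⟩
  sum3 (λ j → 0ℚ * cofactor A i j)                             ≡⟨ vanish (cofactor A i 0F) (cofactor A i 1F) (cofactor A i 2F) ⟩
  0ℚ                                                           ∎) det≢0
  where
  vanish : ∀ a b c → 0ℚ * a + (0ℚ * b + 0ℚ * c) ≡ 0ℚ
  vanish = solve-∀ ℚ-ring

det3-upper : ∀ A → A 1F 0F ≡ 0ℚ → A 2F 0F ≡ 0ℚ → A 2F 1F ≡ 0ℚ → det3 A ≡ A 0F 0F * A 1F 1F * A 2F 2F
det3-upper A a₁₀≡0 a₂₀≡0 a₂₁≡0 =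
  modulo (A 0F 2F * A 2F 1F - A 0F 1F * A 2F 2F) a₁₀≡0 (modulo (A 0F 1F * A 1F 2F - A 0F 2F * A 1F 1F) a₂₀≡0
  (modulo (- (A 0F 0F * A 1F 2F)) a₂₁≡0
    (identity (A 0F 0F) (A 0F 1F) (A 0F 2F) (A 1F 0F) (A 1F 1F) (A 1F 2F) (A 2F 0F) (A 2F 1F) (A 2F 2F))))
  where
  identity : ∀ a₀₀ a₀₁ a₀₂ a₁₀ a₁₁ a₁₂ a₂₀ a₂₁ a₂₂ →
    a₀₀ * (a₁₁ * a₂₂ - a₁₂ * a₂₁) - a₀₁ * (a₁₀ * a₂₂ - a₁₂ * a₂₀) + a₀₂ * (a₁₀ * a₂₁ - a₁₁ * a₂₀)
      ≡ a₀₀ * a₁₁ * a₂₂ + (a₀₂ * a₂₁ - a₀₁ * a₂₂) * (a₁₀ - 0ℚ) + (a₀₁ * a₁₂ - a₀₂ * a₁₁) * (a₂₀ - 0ℚ)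
        + - (a₀₀ * a₁₂) * (a₂₁ - 0ℚ)
  identity = solve-∀ ℚ-ring

Q₀∘φ : ∀ β p → eval (φ β p) Q₀ ≡ eval p Q₁
Q₀∘φ β p = refl

Q₁∘φ : ∀ β p → eval p x₃ ≢ 0ℚ → eval (φ β p) Q₁ ≡ eval p (Q₂ β)
Q₁∘φ β p x₃≢0 = begin
  eval (φ β p) Q₁                      ≡⟨ modulo (a₁ * ι₀) (*-inv x₃≢0) (shifted a₁ a₂ a₃ β ι₀ ι₃) ⟩
  a₁ * ι₀ + a₂ * ι₃ + β * (ι₀ * ι₃)     ≡⟨ cong (λ z → a₁ * ι₀ + a₂ * ι₃ + β * z) (inv-* (eval p x₀) a₃) ⟨
  eval p (Q₂ β)                        ∎
  where
  a₁ = eval p x₁ ; a₂ = eval p x₂ ; a₃ = eval p x₃ ; ι₀ = inv (eval p x₀) ; ι₃ = inv a₃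
  shifted : ∀ x₁ x₂ x₃ β ι₀ ι₃ →
    (x₂ + (x₁ * x₃ + β) * ι₀) * ι₃ ≡ x₁ * ι₀ + x₂ * ι₃ + β * (ι₀ * ι₃) + x₁ * ι₀ * (x₃ * ι₃ - 1ℚ)
  shifted = solve-∀ ℚ-ring

Q₂∘φ : ∀ β p → eval p x₀ ≢ 0ℚ → eval p x₁ ≢ 0ℚ → eval (φ β p) x₃ ≢ 0ℚ →
       eval (φ β p) (Q₂ β) ≡ eval p Q₀
Q₂∘φ β p x₀≢0 x₁≢0 y≢0 = begin
  eval (φ β p) (Q₂ β)                  ≡⟨ cong (λ z → a₂ * ι₁ + a₃ * ιy + β * z) (inv-* a₁ y) ⟩
  a₂ * ι₁ + a₃ * ιy + β * (ι₁ * ιy)    ≡⟨ modulo (- (a₃ * ιy)) (*-inv x₁≢0)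
                                          (modulo (- (ι₁ * ιy * (a₁ * a₃ + β))) (*-inv x₀≢0)
                                          (modulo (a₀ * ι₁) (*-inv y≢0)
                                          (shifted a₀ a₁ a₂ a₃ β ι₀ ι₁ ιy))) ⟩
  eval p Q₀                            ∎
  where
  a₀ = eval p x₀ ; a₁ = eval p x₁ ; a₂ = eval p x₂ ; a₃ = eval p x₃
  ι₀ = inv a₀ ; ι₁ = inv a₁ ; y = eval (φ β p) x₃ ; ιy = inv y
  shifted : ∀ x₀ x₁ x₂ x₃ β ι₀ ι₁ ιy → let y = (x₁ * x₃ + β) * ι₀ in
    x₂ * ι₁ + x₃ * ιy + β * (ι₁ * ιy)
      ≡ (x₀ + x₂) * ι₁ + - (x₃ * ιy) * (x₁ * ι₁ - 1ℚ)
        + - (ι₁ * ιy * (x₁ * x₃ + β)) * (x₀ * ι₀ - 1ℚ) + x₀ * ι₁ * (y * ιy - 1ℚ)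
  shifted = solve-∀ ℚ-ring

J : Fin 3 → ℚ → ℚ → ℚ → ℚ
J 0F a b c = a * b * c - a - b - c
J 1F a b c = a * b + b * c + c * a - (+ 3 / 1)
J 2F a b c = a * b * c

eval-J̃ : ∀ β p k → eval p (J̃ β k) ≡ J k (eval p Q₀) (eval p Q₁) (eval p (Q₂ β))
eval-J̃ β p 0F = refl
eval-J̃ β p 1F = refl
eval-J̃ β p 2F = refl

J-cyclic : ∀ k a b c → J k b c a ≡ J k a b c
J-cyclic 0F = cyc
  where
  cyc : ∀ a b c → b * c * a - b - c - a ≡ a * b * c - a - b - c
  cyc = solve-∀ ℚ-ring
J-cyclic 1F = cyc
  where
  cyc : ∀ a b c → b * c + c * a + a * b - (+ 3 / 1) ≡ a * b + b * c + c * a - (+ 3 / 1)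
  cyc = solve-∀ ℚ-ring
J-cyclic 2F = cyc
  where
  cyc : ∀ a b c → b * c * a ≡ a * b * c
  cyc = solve-∀ ℚ-ring

J̃-rotation : ∀ β p p′ →
             eval p′ Q₀ ≡ eval p Q₁ → eval p′ Q₁ ≡ eval p (Q₂ β) → eval p′ (Q₂ β) ≡ eval p Q₀ →
             ∀ k → eval p′ (J̃ β k) ≡ eval p (J̃ β k)
J̃-rotation β p p′ e₀ e₁ e₂ k = begin
  eval p′ (J̃ β k)                                  ≡⟨ eval-J̃ β p′ k ⟩
  J k (eval p′ Q₀) (eval p′ Q₁) (eval p′ (Q₂ β))   ≡⟨ cong₃ (J k) e₀ e₁ e₂ ⟩
  J k (eval p Q₁) (eval p (Q₂ β)) (eval p Q₀)      ≡⟨ J-cyclic k _ _ _ ⟩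
  J k (eval p Q₀) (eval p Q₁) (eval p (Q₂ β))      ≡⟨ eval-J̃ β p k ⟨
  eval p (J̃ β k)                                   ∎

J̃-conserved : ∀ β p → (∀ i → p i ≢ 0ℚ) → (∀ i → φ β p i ≢ 0ℚ) →
              ∀ k → eval (φ β p) (J̃ β k) ≡ eval p (J̃ β k)
J̃-conserved β p p≢0 φp≢0 = J̃-rotation β p (φ β p) (Q₀∘φ β p)
  (Q₁∘φ β p (p≢0 3F))
  (Q₂∘φ β p (p≢0 0F) (p≢0 1F) (φp≢0 3F))

Solves : ℚ → (ℕ → ℚ) → Set
Solves c z = ∀ n → z (2 ℕ.+ n) ≡ c * z (1 ℕ.+ n) - z n

solution-unique : ∀ {c y z} → Solves c y → Solves c z → y 0 ≡ z 0 → y 1 ≡ z 1 → ∀ n → y n ≡ z n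
solution-unique sy sz e₀ e₁ zero = e₀
solution-unique sy sz e₀ e₁ (suc zero) = e₁
solution-unique {c} {y} {z} sy sz e₀ e₁ (suc (suc n)) = begin
  y (2 ℕ.+ n)                   ≡⟨ sy n ⟩
  c * y (1 ℕ.+ n) - y n         ≡⟨ cong₂ (λ u v → c * u - v) (agree (suc n)) (agree n) ⟩
  c * z (1 ℕ.+ n) - z n         ≡⟨ sz n ⟨
  z (2 ℕ.+ n)                   ∎
  where
  agree = solution-unique {c} {y} {z} sy sz e₀ e₁

solves-linear : ∀ {c y z} A B → Solves c y → Solves c z → Solves c (λ n → A * y n + B * z n)
solves-linear {c} {y} {z} A B sy sz n = begin
  A * y (2 ℕ.+ n) + B * z (2 ℕ.+ n)
    ≡⟨ cong₂ (λ u v → A * u + B * v) (sy n) (sz n) ⟩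
  A * (c * y (1 ℕ.+ n) - y n) + B * (c * z (1 ℕ.+ n) - z n)
    ≡⟨ distribute A B c (y (1 ℕ.+ n)) (y n) (z (1 ℕ.+ n)) (z n) ⟩
  c * (A * y (1 ℕ.+ n) + B * z (1 ℕ.+ n)) - (A * y n + B * z n)
    ∎
  where
  distribute : ∀ A B c y₁ y₀ z₁ z₀ →
    A * (c * y₁ - y₀) + B * (c * z₁ - z₀) ≡ c * (A * y₁ + B * z₁) - (A * y₀ + B * z₀)
  distribute = solve-∀ ℚ-ring

T-solves : ∀ t → Solves ((+ 2 / 1) * t) (λ n → T n t)
T-solves t n = refl

U-solves : ∀ t → Solves ((+ 2 / 1) * t) (λ n → U n t)
U-solves t n = refl

chebyshev-solution : ∀ {c z} → c ≢ 0ℚ → Solves c z → ∀ n →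
  z n ≡ ((+ 2 / 1) * z 0 - (+ 2 / 1) * z 1 * inv c) * T n (c * (+ 1 / 2))
      + (- z 0 + (+ 2 / 1) * z 1 * inv c) * U n (c * (+ 1 / 2))
chebyshev-solution {c} {z} c≢0 sz =
  solution-unique {c} {z} sz (solves-linear {c} {λ n → T n t} {λ n → U n t} A B (solves (T-solves t)) (solves (U-solves t)))
    (initial₀ (z 0) (z 1) (inv c))
    (modulo (- z 1) (*-inv c≢0) (initial₁ (z 0) (z 1) c (inv c)))
  where
  A = (+ 2 / 1) * z 0 - (+ 2 / 1) * z 1 * inv c
  B = - z 0 + (+ 2 / 1) * z 1 * inv c
  t = c * (+ 1 / 2)
  two-halves : ∀ c → (+ 2 / 1) * (c * (+ 1 / 2)) ≡ c
  two-halves = solve-∀ ℚ-ring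
  solves : ∀ {w} → Solves ((+ 2 / 1) * t) w → Solves c w
  solves = subst (λ c′ → Solves c′ _) (two-halves c)
  initial₀ : ∀ z₀ z₁ ι → z₀ ≡ ((+ 2 / 1) * z₀ - (+ 2 / 1) * z₁ * ι) * 1ℚ + (- z₀ + (+ 2 / 1) * z₁ * ι) * 1ℚ
  initial₀ = solve-∀ ℚ-ring
  initial₁ : ∀ z₀ z₁ c ι →
    z₁ ≡ ((+ 2 / 1) * z₀ - (+ 2 / 1) * z₁ * ι) * (c * (+ 1 / 2))
         + (- z₀ + (+ 2 / 1) * z₁ * ι) * ((+ 2 / 1) * (c * (+ 1 / 2))) + - z₁ * (c * ι - 1ℚ)
  initial₁ = solve-∀ ℚ-ring

-- For a three-periodic coefficient sequence the monodromy over one period is a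
-- product of three matrices [[0,1],[-1,aᵢ]] with determinant 1 and trace J 0F a₀ a₁ a₂,
-- so Cayley–Hamilton relates y₆, y₃ and y₀.
monodromy : ∀ a b c y₀ y₁ y₂ y₃ y₄ y₅ y₆ →
  y₂ ≡ a * y₁ - y₀ → y₃ ≡ b * y₂ - y₁ → y₄ ≡ c * y₃ - y₂ → y₅ ≡ a * y₄ - y₃ → y₆ ≡ b * y₅ - y₄ →
  y₆ - J 0F a b c * y₃ + y₀ ≡ 0ℚ
monodromy a b c y₀ y₁ _ _ _ _ _ refl refl refl refl refl = cayley-hamilton a b c y₀ y₁
  where
  cayley-hamilton : ∀ a b c y₀ y₁ →
    let y₂ = a * y₁ - y₀ ; y₃ = b * y₂ - y₁ ; y₄ = c * y₃ - y₂ ; y₅ = a * y₄ - y₃ ; y₆ = b * y₅ - y₄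
    in y₆ - (a * b * c - a - b - c) * y₃ + y₀ ≡ 0ℚ
  cayley-hamilton = solve-∀ ℚ-ring

period-three-recurrence : (y a : ℕ → ℚ) → (∀ n → a (3 ℕ.+ n) ≡ a n) →
  (∀ n → y (2 ℕ.+ n) ≡ a n * y (1 ℕ.+ n) - y n) →
  ∀ n → y (6 ℕ.+ n) - J 0F (a n) (a (1 ℕ.+ n)) (a (2 ℕ.+ n)) * y (3 ℕ.+ n) + y n ≡ 0ℚ
period-three-recurrence y a periodic step n =
  monodromy (a n) (a (1 ℕ.+ n)) (a (2 ℕ.+ n)) (y n) (y (1 ℕ.+ n)) _ _ _ _ _
  (step n) (step (1 ℕ.+ n)) (step (2 ℕ.+ n))
  (trans (step (3 ℕ.+ n)) (cong (λ c → c * y (4 ℕ.+ n) - y (3 ℕ.+ n)) (periodic n)))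
  (trans (step (4 ℕ.+ n)) (cong (λ c → c * y (5 ℕ.+ n) - y (4 ℕ.+ n)) (periodic (1 ℕ.+ n))))

eval-cong : ∀ {p p′ : Pt} → (∀ i → p i ≡ p′ i) → ∀ e → eval p e ≡ eval p′ e
eval-cong p≡p′ (X i) = p≡p′ i
eval-cong p≡p′ (K c) = refl
eval-cong p≡p′ (e ⊕ f) = cong₂ _+_ (eval-cong p≡p′ e) (eval-cong p≡p′ f)
eval-cong p≡p′ (e ⊗ f) = cong₂ _*_ (eval-cong p≡p′ e) (eval-cong p≡p′ f)
eval-cong p≡p′ (neg e) = cong -_ (eval-cong p≡p′ e)
eval-cong p≡p′ (rec e) = cong inv (eval-cong p≡p′ e)

orbit : ℚ → Pt → ℕ → Pt
orbit β p n 0F = seq β p n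
orbit β p n 1F = seq β p (suc n)
orbit β p n 2F = seq β p (suc (suc n))
orbit β p n 3F = seq β p (suc (suc (suc n)))

orbit-zero : ∀ β p i → orbit β p 0 i ≡ p i
orbit-zero β p 0F = refl
orbit-zero β p 1F = refl
orbit-zero β p 2F = refl
orbit-zero β p 3F = refl

orbit-suc : ∀ β p n i → orbit β p (suc n) i ≡ φ β (orbit β p n) i
orbit-suc β p n 0F = refl
orbit-suc β p n 1F = refl
orbit-suc β p n 2F = refl
orbit-suc β p n 3F = refl

orbit-≢0 : ∀ β p → (∀ n → seq β p n ≢ 0ℚ) → ∀ n i → orbit β p n i ≢ 0ℚ
orbit-≢0 β p x≢0 n 0F = x≢0 n
orbit-≢0 β p x≢0 n 1F = x≢0 (suc n)
orbit-≢0 β p x≢0 n 2F = x≢0 (suc (suc n))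
orbit-≢0 β p x≢0 n 3F = x≢0 (suc (suc (suc n)))

module Orbit (β : ℚ) (p : Pt) (x≢0 : ∀ n → seq β p n ≢ 0ℚ) where

  x : ℕ → ℚ
  x = seq β p

  J̃-along-orbit : ∀ n k → eval (orbit β p n) (J̃ β k) ≡ eval p (J̃ β k)
  J̃-along-orbit zero k = eval-cong (orbit-zero β p) (J̃ β k)
  J̃-along-orbit (suc n) k = begin
    eval (orbit β p (suc n)) (J̃ β k)       ≡⟨ eval-cong (orbit-suc β p n) (J̃ β k) ⟩
    eval (φ β (orbit β p n)) (J̃ β k)       ≡⟨ J̃-conserved β (orbit β p n) (orbit-≢0 β p x≢0 n) φ-orbit≢0 k ⟩
    eval (orbit β p n) (J̃ β k)             ≡⟨ J̃-along-orbit n k ⟩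
    eval p (J̃ β k)                         ∎
    where
    φ-orbit≢0 : ∀ i → φ β (orbit β p n) i ≢ 0ℚ
    φ-orbit≢0 i = subst (_≢ 0ℚ) (orbit-suc β p n i) (orbit-≢0 β p x≢0 (suc n) i)

  a : ℕ → ℚ
  a n = eval (orbit β p n) Q₀

  Q₁-orbit-shift : ∀ n → eval (orbit β p (suc n)) Q₁ ≡ eval (orbit β p n) (Q₂ β)
  Q₁-orbit-shift n = Q₁∘φ β (orbit β p n) (x≢0 (3 ℕ.+ n))

  Q₂-orbit-shift : ∀ n → eval (orbit β p (suc n)) (Q₂ β) ≡ a n
  Q₂-orbit-shift n = Q₂∘φ β (orbit β p n) (x≢0 n) (x≢0 (1 ℕ.+ n)) (x≢0 (4 ℕ.+ n))

  a-periodic : ∀ n → a (3 ℕ.+ n) ≡ a n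
  a-periodic n = trans (Q₁-orbit-shift (suc n)) (Q₂-orbit-shift n)

  x-recurrence : ∀ n → x (2 ℕ.+ n) ≡ a n * x (1 ℕ.+ n) - x n
  x-recurrence n = modulo (- (x n + x (2 ℕ.+ n))) (*-inv (x≢0 (1 ℕ.+ n)))
    (quotient (x n) (x (1 ℕ.+ n)) (x (2 ℕ.+ n)) (inv (x (1 ℕ.+ n))))
    where
    quotient : ∀ x₀ x₁ x₂ ι₁ → x₂ ≡ (x₀ + x₂) * ι₁ * x₁ - x₀ + - (x₀ + x₂) * (x₁ * ι₁ - 1ℚ)
    quotient = solve-∀ ℚ-ring

  J̃₁-as-trace : ∀ n → eval p (J̃₁ β) ≡ J 0F (a n) (a (1 ℕ.+ n)) (a (2 ℕ.+ n))
  J̃₁-as-trace n = begin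
    eval p (J̃₁ β)                          ≡⟨ J̃-along-orbit n 0F ⟨
    eval (orbit β p n) (J̃₁ β)              ≡⟨ cong (J 0F (a n) (a (1 ℕ.+ n))) (Q₁-orbit-shift n) ⟨
    J 0F (a n) (a (1 ℕ.+ n)) (a (2 ℕ.+ n)) ∎

iterates-recurrence : ∀ β p → (∀ n → seq β p n ≢ 0ℚ) →
  ∀ n → seq β p (6 ℕ.+ n) - eval p (J̃₁ β) * seq β p (3 ℕ.+ n) + seq β p n ≡ 0ℚ
iterates-recurrence β p x≢0 n = begin
  x (6 ℕ.+ n) - eval p (J̃₁ β) * x (3 ℕ.+ n) + x n
    ≡⟨ cong (λ t → x (6 ℕ.+ n) - t * x (3 ℕ.+ n) + x n) (J̃₁-as-trace n) ⟩
  x (6 ℕ.+ n) - J 0F (a n) (a (1 ℕ.+ n)) (a (2 ℕ.+ n)) * x (3 ℕ.+ n) + x n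
    ≡⟨ period-three-recurrence x a a-periodic x-recurrence n ⟩
  0ℚ ∎
  where open Orbit β p x≢0

iterates-chebyshev : ∀ β p → (∀ n → seq β p n ≢ 0ℚ) → eval p (J̃₁ β) ≢ 0ℚ →
  ∀ n (j : Fin 3) →
    seq β p (3 ℕ.* n ℕ.+ toℕ j)
      ≡ ((+ 2 / 1) * seq β p (toℕ j) - (+ 2 / 1) * seq β p (3 ℕ.+ toℕ j) * inv (eval p (J̃₁ β)))
          * T n (eval p (J̃₁ β) * (+ 1 / 2))
        + (- seq β p (toℕ j) + (+ 2 / 1) * seq β p (3 ℕ.+ toℕ j) * inv (eval p (J̃₁ β)))
          * U n (eval p (J̃₁ β) * (+ 1 / 2))
iterates-chebyshev β p x≢0 J≢0 n j = chebyshev-solution J≢0 every-third n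
  where
  x = seq β p
  every-third : Solves (eval p (J̃₁ β)) (λ m → x (3 ℕ.* m ℕ.+ toℕ j))
  every-third m = begin
    x (3 ℕ.* (2 ℕ.+ m) ℕ.+ toℕ j)     ≡⟨ cong x (index₆ m (toℕ j)) ⟩
    x (6 ℕ.+ k)                      ≡⟨ rearrange (iterates-recurrence β p x≢0 k) ⟩
    eval p (J̃₁ β) * x (3 ℕ.+ k) - x k ≡⟨ cong (λ i → eval p (J̃₁ β) * x i - x k) (index₃ m (toℕ j)) ⟨
    eval p (J̃₁ β) * x (3 ℕ.* (1 ℕ.+ m) ℕ.+ toℕ j) - x k ∎
    where
    k = 3 ℕ.* m ℕ.+ toℕ j
    index₆ : ∀ m i → 3 ℕ.* (2 ℕ.+ m) ℕ.+ i ≡ 6 ℕ.+ (3 ℕ.* m ℕ.+ i)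
    index₆ = ℕ-Solver.solve-∀
    index₃ : ∀ m i → 3 ℕ.* (1 ℕ.+ m) ℕ.+ i ≡ 3 ℕ.+ (3 ℕ.* m ℕ.+ i)
    index₃ = ℕ-Solver.solve-∀
    rearrange : ∀ {u v w} → u - v + w ≡ 0ℚ → u ≡ v - w
    rearrange {u} {v} {w} e = difference-zero (trans (regroup u v w) e)
      where
      regroup : ∀ u v w → u - (v - w) ≡ u - v + w
      regroup = solve-∀ ℚ-ring

⟪_,_⟫ : (Fin 4 → ℚ) → (Fin 4 → ℚ) → ℚ
⟪ u , v ⟫ = sum4 λ i → sum4 λ j → ω i j * u i * v j

⟪⟫-cong : ∀ {u u′ v v′ : Fin 4 → ℚ} → (∀ i → u i ≡ u′ i) → (∀ j → v j ≡ v′ j) →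
          ⟪ u , v ⟫ ≡ ⟪ u′ , v′ ⟫
⟪⟫-cong u≡u′ v≡v′ = sum4-cong λ i → sum4-cong λ j → cong₂ (λ a b → ω i j * a * b) (u≡u′ i) (v≡v′ j)

double-sum-linear : ∀ (F : Fin 4 → Fin 4 → ℚ) (a : Fin 3 → ℚ) (G : Fin 3 → Fin 4 → Fin 4 → ℚ) →
  (∀ i j → F i j ≡ sum3 (λ l → a l * G l i j)) →
  sum4 (λ i → sum4 (F i)) ≡ sum3 (λ l → a l * sum4 (λ i → sum4 (G l i)))
double-sum-linear F a G F≡ = begin
  sum4 (λ i → sum4 (F i))                                  ≡⟨ sum4-cong (λ i → sum4-cong (F≡ i)) ⟩
  sum4 (λ i → sum4 (λ j → sum3 (λ l → a l * G l i j)))     ≡⟨ sum4-cong (λ i → sum4-sum3 (λ l j → a l * G l i j)) ⟩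
  sum4 (λ i → sum3 (λ l → sum4 (λ j → a l * G l i j)))     ≡⟨ sum4-sum3 (λ l i → sum4 (λ j → a l * G l i j)) ⟩
  sum3 (λ l → sum4 (λ i → sum4 (λ j → a l * G l i j)))
    ≡⟨ sum3-cong (λ l → trans (sum4-cong (λ i → sum4-scale (a l) (G l i))) (sum4-scale (a l) (λ i → sum4 (G l i)))) ⟩
  sum3 (λ l → a l * sum4 (λ i → sum4 (G l i)))             ∎

⟪⟫-linearˡ : ∀ {u v : Fin 4 → ℚ} (a : Fin 3 → ℚ) (w : Fin 3 → Fin 4 → ℚ) →
             (∀ i → u i ≡ sum3 (λ l → a l * w l i)) →
             ⟪ u , v ⟫ ≡ sum3 (λ l → a l * ⟪ w l , v ⟫)
⟪⟫-linearˡ {u} {v} a w u≡ =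
  double-sum-linear (λ i j → ω i j * u i * v j) a (λ l i j → ω i j * w l i * v j) λ i j →
  trans (cong (λ t → ω i j * t * v j) (u≡ i))
        (spread (ω i j) (v j) (a 0F) (a 1F) (a 2F) (w 0F i) (w 1F i) (w 2F i))
  where
  spread : ∀ o v a₀ a₁ a₂ w₀ w₁ w₂ →
    o * (a₀ * w₀ + (a₁ * w₁ + a₂ * w₂)) * v ≡ a₀ * (o * w₀ * v) + (a₁ * (o * w₁ * v) + a₂ * (o * w₂ * v))
  spread = solve-∀ ℚ-ring

⟪⟫-linearʳ : ∀ {u v : Fin 4 → ℚ} (a : Fin 3 → ℚ) (w : Fin 3 → Fin 4 → ℚ) →
             (∀ j → v j ≡ sum3 (λ l → a l * w l j)) →
             ⟪ u , v ⟫ ≡ sum3 (λ l → a l * ⟪ u , w l ⟫)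
⟪⟫-linearʳ {u} {v} a w v≡ =
  double-sum-linear (λ i j → ω i j * u i * v j) a (λ l i j → ω i j * u i * w l j) λ i j →
  trans (cong (λ t → ω i j * u i * t) (v≡ j))
        (spread (ω i j) (u i) (a 0F) (a 1F) (a 2F) (w 0F j) (w 1F j) (w 2F j))
  where
  spread : ∀ o u a₀ a₁ a₂ w₀ w₁ w₂ →
    o * u * (a₀ * w₀ + (a₁ * w₁ + a₂ * w₂)) ≡ a₀ * (o * u * w₀) + (a₁ * (o * u * w₁) + a₂ * (o * u * w₂))
  spread = solve-∀ ℚ-ring

⟪⟫-expand : ∀ u v → ⟪ u , v ⟫ ≡ (u 0F * v 1F - u 1F * v 0F) + (u 0F * v 3F - u 3F * v 0F)
                                 + (u 1F * v 2F - u 2F * v 1F) + (u 2F * v 3F - u 3F * v 2F)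
⟪⟫-expand u v = expansion (u 0F) (u 1F) (u 2F) (u 3F) (v 0F) (v 1F) (v 2F) (v 3F)
  where
  expansion : ∀ u₀ u₁ u₂ u₃ v₀ v₁ v₂ v₃ →
      (0ℚ * u₀ * v₀ + (1ℚ * u₀ * v₁ + (0ℚ * u₀ * v₂ + 1ℚ * u₀ * v₃)))
    + ((- 1ℚ * u₁ * v₀ + (0ℚ * u₁ * v₁ + (1ℚ * u₁ * v₂ + 0ℚ * u₁ * v₃)))
    + ((0ℚ * u₂ * v₀ + (- 1ℚ * u₂ * v₁ + (0ℚ * u₂ * v₂ + 1ℚ * u₂ * v₃)))
    + (- 1ℚ * u₃ * v₀ + (0ℚ * u₃ * v₁ + (- 1ℚ * u₃ * v₂ + 0ℚ * u₃ * v₃)))))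
    ≡ (u₀ * v₁ - u₁ * v₀) + (u₀ * v₃ - u₃ * v₀) + (u₁ * v₂ - u₂ * v₁) + (u₂ * v₃ - u₃ * v₂)
  expansion = solve-∀ ℚ-ring

⟪⟫-self : ∀ u → ⟪ u , u ⟫ ≡ 0ℚ
⟪⟫-self u = trans (⟪⟫-expand u u) (cancel (u 0F) (u 1F) (u 2F) (u 3F))
  where
  cancel : ∀ u₀ u₁ u₂ u₃ →
    (u₀ * u₁ - u₁ * u₀) + (u₀ * u₃ - u₃ * u₀) + (u₁ * u₂ - u₂ * u₁) + (u₂ * u₃ - u₃ * u₂) ≡ 0ℚ
  cancel = solve-∀ ℚ-ring

⟪⟫-antisym : ∀ u v → ⟪ u , v ⟫ ≡ - ⟪ v , u ⟫
⟪⟫-antisym u v = trans (⟪⟫-expand u v) (trans (flip (u 0F) (u 1F) (u 2F) (u 3F) (v 0F) (v 1F) (v 2F) (v 3F))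
                                              (cong -_ (sym (⟪⟫-expand v u))))
  where
  flip : ∀ u₀ u₁ u₂ u₃ v₀ v₁ v₂ v₃ →
    (u₀ * v₁ - u₁ * v₀) + (u₀ * v₃ - u₃ * v₀) + (u₁ * v₂ - u₂ * v₁) + (u₂ * v₃ - u₃ * v₂)
      ≡ - ((v₀ * u₁ - v₁ * u₀) + (v₀ * u₃ - v₃ * u₀) + (v₁ * u₂ - v₂ * u₁) + (v₂ * u₃ - v₃ * u₂))
  flip = solve-∀ ℚ-ring

logGrad : Pt → Expr → Fin 4 → ℚ
logGrad p f i = p i * eval p (∂ i f)

pb₀-logGrad : ∀ f g p → pb₀ f g p ≡ ⟪ logGrad p f , logGrad p g ⟫
pb₀-logGrad f g p = sum4-cong λ i → sum4-cong λ j → regroup (ω i j) (p i) (p j) (eval p (∂ i f)) (eval p (∂ j g))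
  where
  regroup : ∀ o x y a b → o * x * y * a * b ≡ o * (x * a) * (y * b)
  regroup = solve-∀ ℚ-ring

∂J̃∂Q : ℚ → ℚ → ℚ → Fin 3 → Fin 3 → ℚ
∂J̃∂Q a b c 0F 0F = b * c - 1ℚ
∂J̃∂Q a b c 0F 1F = a * c - 1ℚ
∂J̃∂Q a b c 0F 2F = a * b - 1ℚ
∂J̃∂Q a b c 1F 0F = b + c
∂J̃∂Q a b c 1F 1F = a + c
∂J̃∂Q a b c 1F 2F = a + b
∂J̃∂Q a b c 2F 0F = b * c
∂J̃∂Q a b c 2F 1F = a * c
∂J̃∂Q a b c 2F 2F = a * b

jacobian : ℚ → Pt → Fin 3 → Fin 3 → ℚ
jacobian β p = ∂J̃∂Q (eval p Q₀) (eval p Q₁) (eval p (Q₂ β))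

-- Each `chain` has as left-hand side the unfolding of xᵢ ∂ᵢ J̃ₖ by ∂ and eval.
logGrad-J̃ : ∀ β p k i → logGrad p (J̃ β k) i ≡ sum3 (λ l → jacobian β p k l * logGrad p (Q β l) i)
logGrad-J̃ β p 0F i = chain (p i) (eval p Q₀) (eval p Q₁) (eval p (Q₂ β))
  (eval p (∂ i Q₀)) (eval p (∂ i Q₁)) (eval p (∂ i (Q₂ β)))
  where
  chain : ∀ x q₀ q₁ q₂ d₀ d₁ d₂ →
    x * (((d₀ * q₁ + q₀ * d₁) * q₂ + q₀ * q₁ * d₂) + - d₀ + - d₁ + - d₂)
      ≡ (q₁ * q₂ - 1ℚ) * (x * d₀) + ((q₀ * q₂ - 1ℚ) * (x * d₁) + (q₀ * q₁ - 1ℚ) * (x * d₂))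
  chain = solve-∀ ℚ-ring
logGrad-J̃ β p 1F i = chain (p i) (eval p Q₀) (eval p Q₁) (eval p (Q₂ β))
  (eval p (∂ i Q₀)) (eval p (∂ i Q₁)) (eval p (∂ i (Q₂ β)))
  where
  chain : ∀ x q₀ q₁ q₂ d₀ d₁ d₂ →
    x * ((d₀ * q₁ + q₀ * d₁) + (d₁ * q₂ + q₁ * d₂) + (d₂ * q₀ + q₂ * d₀) + - 0ℚ)
      ≡ (q₁ + q₂) * (x * d₀) + ((q₀ + q₂) * (x * d₁) + (q₀ + q₁) * (x * d₂))
  chain = solve-∀ ℚ-ring
logGrad-J̃ β p 2F i = chain (p i) (eval p Q₀) (eval p Q₁) (eval p (Q₂ β))
  (eval p (∂ i Q₀)) (eval p (∂ i Q₁)) (eval p (∂ i (Q₂ β)))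
  where
  chain : ∀ x q₀ q₁ q₂ d₀ d₁ d₂ →
    x * ((d₀ * q₁ + q₀ * d₁) * q₂ + q₀ * q₁ * d₂)
      ≡ q₁ * q₂ * (x * d₀) + (q₀ * q₂ * (x * d₁) + q₀ * q₁ * (x * d₂))
  chain = solve-∀ ℚ-ring

ξQ : ℚ → Pt → Fin 3 → Fin 4 → ℚ
ξQ β p 0F 0F = p 0F * inv (p 1F)
ξQ β p 0F 1F = - ((p 0F + p 2F) * inv (p 1F))
ξQ β p 0F 2F = p 2F * inv (p 1F)
ξQ β p 0F 3F = 0ℚ
ξQ β p 1F 0F = 0ℚ
ξQ β p 1F 1F = p 1F * inv (p 2F)
ξQ β p 1F 2F = - ((p 1F + p 3F) * inv (p 2F))
ξQ β p 1F 3F = p 3F * inv (p 2F)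
ξQ β p 2F 0F = - (p 1F * inv (p 0F) + β * inv (p 0F * p 3F))
ξQ β p 2F 1F = p 1F * inv (p 0F)
ξQ β p 2F 2F = p 2F * inv (p 3F)
ξQ β p 2F 3F = - (p 2F * inv (p 3F) + β * inv (p 0F * p 3F))

-- The left-hand sides are xᵢ ∂ᵢ(N / x) as ∂ unfolds it, for xᵢ a summand of N, absent, or x itself.
ratio-numerator : ∀ x ι N κ → x * (1ℚ * ι + N * - (0ℚ * κ)) ≡ x * ι
ratio-numerator = solve-∀ ℚ-ring

ratio-absent : ∀ x ι N κ → x * (0ℚ * ι + N * - (0ℚ * κ)) ≡ 0ℚ
ratio-absent = solve-∀ ℚ-ring

ratio-denominator : ∀ {x} N → x ≢ 0ℚ → x * (0ℚ * inv x + N * - (1ℚ * inv (x * x))) ≡ - (N * inv x)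
ratio-denominator {x} N x≢0 = modulo (- (N * inv x)) (*-inv x≢0)
  (modulo (- (x * N)) (inv-* x x) (identity x N (inv x) (inv (x * x))))
  where
  identity : ∀ x N ι σ → x * (0ℚ * ι + N * - (1ℚ * σ)) ≡ - (N * ι) + - (N * ι) * (x * ι - 1ℚ) + - (x * N) * (σ - ι * ι)
  identity = solve-∀ ℚ-ring

logGrad-Q : ∀ β p → (∀ i → p i ≢ 0ℚ) → ∀ l i → logGrad p (Q β l) i ≡ ξQ β p l i
logGrad-Q β p p≢0 0F 0F = ratio-numerator (p 0F) (inv (p 1F)) (p 0F + p 2F) (inv (p 1F * p 1F))
logGrad-Q β p p≢0 0F 1F = ratio-denominator (p 0F + p 2F) (p≢0 1F)
logGrad-Q β p p≢0 0F 2F = ratio-numerator (p 2F) (inv (p 1F)) (p 0F + p 2F) (inv (p 1F * p 1F))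
logGrad-Q β p p≢0 0F 3F = ratio-absent (p 3F) (inv (p 1F)) (p 0F + p 2F) (inv (p 1F * p 1F))
logGrad-Q β p p≢0 1F 0F = ratio-absent (p 0F) (inv (p 2F)) (p 1F + p 3F) (inv (p 2F * p 2F))
logGrad-Q β p p≢0 1F 1F = ratio-numerator (p 1F) (inv (p 2F)) (p 1F + p 3F) (inv (p 2F * p 2F))
logGrad-Q β p p≢0 1F 2F = ratio-denominator (p 1F + p 3F) (p≢0 2F)
logGrad-Q β p p≢0 1F 3F = ratio-numerator (p 3F) (inv (p 2F)) (p 1F + p 3F) (inv (p 2F * p 2F))
logGrad-Q β p p≢0 2F 0F =
  modulo (- (a₀ * a₁)) (inv-* a₀ a₀) (modulo (- (β * a₀ * a₃)) (inv-* (a₀ * a₃) (a₀ * a₃))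
  (modulo (- (a₁ * ι₀)) (*-inv (p≢0 0F)) (modulo (- (β * κ)) (*-inv (*-≢0 (p≢0 0F) (p≢0 3F)))
  (identity a₀ a₁ a₂ a₃ β ι₀ ι₃ κ (inv (a₀ * a₀)) (inv (a₃ * a₃)) (inv (a₀ * a₃ * (a₀ * a₃)))))))
  where
  a₀ = p 0F ; a₁ = p 1F ; a₂ = p 2F ; a₃ = p 3F ; ι₀ = inv a₀ ; ι₃ = inv a₃ ; κ = inv (a₀ * a₃)
  identity : ∀ x₀ x₁ x₂ x₃ β ι₀ ι₃ κ σ₀ σ₃ τ →
    x₀ * (((0ℚ * ι₀ + x₁ * - (1ℚ * σ₀)) + (0ℚ * ι₃ + x₂ * - (0ℚ * σ₃))) + (0ℚ * κ + β * - ((1ℚ * x₃ + x₀ * 0ℚ) * τ)))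
      ≡ - (x₁ * ι₀ + β * κ) + - (x₀ * x₁) * (σ₀ - ι₀ * ι₀) + - (β * x₀ * x₃) * (τ - κ * κ)
        + - (x₁ * ι₀) * (x₀ * ι₀ - 1ℚ) + - (β * κ) * (x₀ * x₃ * κ - 1ℚ)
  identity = solve-∀ ℚ-ring
logGrad-Q β p p≢0 2F 1F = identity (p 0F) (p 1F) (p 2F) (p 3F) β (inv (p 0F)) (inv (p 3F)) (inv (p 0F * p 3F))
  (inv (p 0F * p 0F)) (inv (p 3F * p 3F)) (inv (p 0F * p 3F * (p 0F * p 3F)))
  where
  identity : ∀ x₀ x₁ x₂ x₃ β ι₀ ι₃ κ σ₀ σ₃ τ →
    x₁ * (((1ℚ * ι₀ + x₁ * - (0ℚ * σ₀)) + (0ℚ * ι₃ + x₂ * - (0ℚ * σ₃))) + (0ℚ * κ + β * - ((0ℚ * x₃ + x₀ * 0ℚ) * τ)))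
      ≡ x₁ * ι₀
  identity = solve-∀ ℚ-ring
logGrad-Q β p p≢0 2F 2F = identity (p 0F) (p 1F) (p 2F) (p 3F) β (inv (p 0F)) (inv (p 3F)) (inv (p 0F * p 3F))
  (inv (p 0F * p 0F)) (inv (p 3F * p 3F)) (inv (p 0F * p 3F * (p 0F * p 3F)))
  where
  identity : ∀ x₀ x₁ x₂ x₃ β ι₀ ι₃ κ σ₀ σ₃ τ →
    x₂ * (((0ℚ * ι₀ + x₁ * - (0ℚ * σ₀)) + (1ℚ * ι₃ + x₂ * - (0ℚ * σ₃))) + (0ℚ * κ + β * - ((0ℚ * x₃ + x₀ * 0ℚ) * τ)))
      ≡ x₂ * ι₃
  identity = solve-∀ ℚ-ring
logGrad-Q β p p≢0 2F 3F =
  modulo (- (a₂ * a₃)) (inv-* a₃ a₃) (modulo (- (β * a₀ * a₃)) (inv-* (a₀ * a₃) (a₀ * a₃))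
  (modulo (- (a₂ * ι₃)) (*-inv (p≢0 3F)) (modulo (- (β * κ)) (*-inv (*-≢0 (p≢0 0F) (p≢0 3F)))
  (identity a₀ a₁ a₂ a₃ β ι₀ ι₃ κ (inv (a₀ * a₀)) (inv (a₃ * a₃)) (inv (a₀ * a₃ * (a₀ * a₃)))))))
  where
  a₀ = p 0F ; a₁ = p 1F ; a₂ = p 2F ; a₃ = p 3F ; ι₀ = inv a₀ ; ι₃ = inv a₃ ; κ = inv (a₀ * a₃)
  identity : ∀ x₀ x₁ x₂ x₃ β ι₀ ι₃ κ σ₀ σ₃ τ →
    x₃ * (((0ℚ * ι₀ + x₁ * - (0ℚ * σ₀)) + (0ℚ * ι₃ + x₂ * - (1ℚ * σ₃))) + (0ℚ * κ + β * - ((0ℚ * x₃ + x₀ * 1ℚ) * τ)))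
      ≡ - (x₂ * ι₃ + β * κ) + - (x₂ * x₃) * (σ₃ - ι₃ * ι₃) + - (β * x₀ * x₃) * (τ - κ * κ)
        + - (x₂ * ι₃) * (x₃ * ι₃ - 1ℚ) + - (β * κ) * (x₀ * x₃ * κ - 1ℚ)
  identity = solve-∀ ℚ-ring

bracketQ : ℚ → ℚ → ℚ → Fin 3 → Fin 3 → ℚ
bracketQ a b c 0F 0F = 0ℚ
bracketQ a b c 0F 1F = (+ 2 / 1) * (a * b - 1ℚ)
bracketQ a b c 0F 2F = - ((+ 2 / 1) * (c * a - 1ℚ))
bracketQ a b c 1F 0F = - ((+ 2 / 1) * (a * b - 1ℚ))
bracketQ a b c 1F 1F = 0ℚ
bracketQ a b c 1F 2F = (+ 2 / 1) * (b * c - 1ℚ)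
bracketQ a b c 2F 0F = (+ 2 / 1) * (c * a - 1ℚ)
bracketQ a b c 2F 1F = - ((+ 2 / 1) * (b * c - 1ℚ))
bracketQ a b c 2F 2F = 0ℚ

ξQ-bracket : ∀ β p → (∀ i → p i ≢ 0ℚ) → ∀ l m →
  ⟪ ξQ β p l , ξQ β p m ⟫ ≡ bracketQ (eval p Q₀) (eval p Q₁) (eval p (Q₂ β)) l m
ξQ-bracket β p p≢0 0F 0F = ⟪⟫-self (ξQ β p 0F)
ξQ-bracket β p p≢0 1F 1F = ⟪⟫-self (ξQ β p 1F)
ξQ-bracket β p p≢0 2F 2F = ⟪⟫-self (ξQ β p 2F)
ξQ-bracket β p p≢0 0F 1F = trans (⟪⟫-expand (ξQ β p 0F) (ξQ β p 1F))
  (modulo (- ((+ 2 / 1) * (p 2F * inv (p 2F)))) (*-inv (p≢0 1F)) (modulo (- (+ 2 / 1)) (*-inv (p≢0 2F))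
  (identity (p 0F) (p 1F) (p 2F) (p 3F) (inv (p 1F)) (inv (p 2F)))))
  where
  identity : ∀ x₀ x₁ x₂ x₃ ι₁ ι₂ →
    let u₀ = x₀ * ι₁ ; u₁ = - ((x₀ + x₂) * ι₁) ; u₂ = x₂ * ι₁ ; u₃ = 0ℚ
        v₀ = 0ℚ ; v₁ = x₁ * ι₂ ; v₂ = - ((x₁ + x₃) * ι₂) ; v₃ = x₃ * ι₂
    in (u₀ * v₁ - u₁ * v₀) + (u₀ * v₃ - u₃ * v₀) + (u₁ * v₂ - u₂ * v₁) + (u₂ * v₃ - u₃ * v₂)
       ≡ (+ 2 / 1) * ((x₀ + x₂) * ι₁ * ((x₁ + x₃) * ι₂) - 1ℚ)
         + - ((+ 2 / 1) * (x₂ * ι₂)) * (x₁ * ι₁ - 1ℚ) + - (+ 2 / 1) * (x₂ * ι₂ - 1ℚ)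
  identity = solve-∀ ℚ-ring
ξQ-bracket β p p≢0 1F 2F = trans (⟪⟫-expand (ξQ β p 1F) (ξQ β p 2F))
  (modulo (- ((+ 2 / 1) * (p 2F * inv (p 2F)))) (*-inv (p≢0 3F)) (modulo (- (+ 2 / 1)) (*-inv (p≢0 2F))
  (identity (p 0F) (p 1F) (p 2F) (p 3F) β (inv (p 0F)) (inv (p 2F)) (inv (p 3F)) (inv (p 0F * p 3F)))))
  where
  identity : ∀ x₀ x₁ x₂ x₃ β ι₀ ι₂ ι₃ κ →
    let u₀ = 0ℚ ; u₁ = x₁ * ι₂ ; u₂ = - ((x₁ + x₃) * ι₂) ; u₃ = x₃ * ι₂
        v₀ = - (x₁ * ι₀ + β * κ) ; v₁ = x₁ * ι₀ ; v₂ = x₂ * ι₃ ; v₃ = - (x₂ * ι₃ + β * κ)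
    in (u₀ * v₁ - u₁ * v₀) + (u₀ * v₃ - u₃ * v₀) + (u₁ * v₂ - u₂ * v₁) + (u₂ * v₃ - u₃ * v₂)
       ≡ (+ 2 / 1) * ((x₁ + x₃) * ι₂ * (x₁ * ι₀ + x₂ * ι₃ + β * κ) - 1ℚ)
         + - ((+ 2 / 1) * (x₂ * ι₂)) * (x₃ * ι₃ - 1ℚ) + - (+ 2 / 1) * (x₂ * ι₂ - 1ℚ)
  identity = solve-∀ ℚ-ring
ξQ-bracket β p p≢0 2F 0F = trans (⟪⟫-expand (ξQ β p 2F) (ξQ β p 0F))
  (modulo (- ((+ 2 / 1) * (p 1F * inv (p 1F)))) (*-inv (p≢0 0F)) (modulo (- (+ 2 / 1)) (*-inv (p≢0 1F))
  (identity (p 0F) (p 1F) (p 2F) (p 3F) β (inv (p 0F)) (inv (p 1F)) (inv (p 3F)) (inv (p 0F * p 3F)))))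
  where
  identity : ∀ x₀ x₁ x₂ x₃ β ι₀ ι₁ ι₃ κ →
    let u₀ = - (x₁ * ι₀ + β * κ) ; u₁ = x₁ * ι₀ ; u₂ = x₂ * ι₃ ; u₃ = - (x₂ * ι₃ + β * κ)
        v₀ = x₀ * ι₁ ; v₁ = - ((x₀ + x₂) * ι₁) ; v₂ = x₂ * ι₁ ; v₃ = 0ℚ
    in (u₀ * v₁ - u₁ * v₀) + (u₀ * v₃ - u₃ * v₀) + (u₁ * v₂ - u₂ * v₁) + (u₂ * v₃ - u₃ * v₂)
       ≡ (+ 2 / 1) * ((x₁ * ι₀ + x₂ * ι₃ + β * κ) * ((x₀ + x₂) * ι₁) - 1ℚ)
         + - ((+ 2 / 1) * (x₁ * ι₁)) * (x₀ * ι₀ - 1ℚ) + - (+ 2 / 1) * (x₁ * ι₁ - 1ℚ)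
  identity = solve-∀ ℚ-ring
ξQ-bracket β p p≢0 1F 0F = trans (⟪⟫-antisym (ξQ β p 1F) (ξQ β p 0F)) (cong -_ (ξQ-bracket β p p≢0 0F 1F))
ξQ-bracket β p p≢0 2F 1F = trans (⟪⟫-antisym (ξQ β p 2F) (ξQ β p 1F)) (cong -_ (ξQ-bracket β p p≢0 1F 2F))
ξQ-bracket β p p≢0 0F 2F = trans (⟪⟫-antisym (ξQ β p 0F) (ξQ β p 2F)) (cong -_ (ξQ-bracket β p p≢0 2F 0F))

casimir : ∀ a b c m → sum3 (λ l → ∂J̃∂Q a b c 0F l * bracketQ a b c l m) ≡ 0ℚ
casimir a b c 0F = identity a b c
  where
  identity : ∀ a b c →
    (b * c - 1ℚ) * 0ℚ + ((a * c - 1ℚ) * - ((+ 2 / 1) * (a * b - 1ℚ)) + (a * b - 1ℚ) * ((+ 2 / 1) * (c * a - 1ℚ))) ≡ 0ℚ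
  identity = solve-∀ ℚ-ring
casimir a b c 1F = identity a b c
  where
  identity : ∀ a b c →
    (b * c - 1ℚ) * ((+ 2 / 1) * (a * b - 1ℚ)) + ((a * c - 1ℚ) * 0ℚ + (a * b - 1ℚ) * - ((+ 2 / 1) * (b * c - 1ℚ))) ≡ 0ℚ
  identity = solve-∀ ℚ-ring
casimir a b c 2F = identity a b c
  where
  identity : ∀ a b c →
    (b * c - 1ℚ) * - ((+ 2 / 1) * (c * a - 1ℚ)) + ((a * c - 1ℚ) * ((+ 2 / 1) * (b * c - 1ℚ)) + (a * b - 1ℚ) * 0ℚ) ≡ 0ℚ
  identity = solve-∀ ℚ-ring

J̃₁-Q-bracket : ∀ β p → (∀ i → p i ≢ 0ℚ) → ∀ m → pb₀ (J̃₁ β) (Q β m) p ≡ 0ℚ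
J̃₁-Q-bracket β p p≢0 m = begin
  pb₀ (J̃₁ β) (Q β m) p                                       ≡⟨ pb₀-logGrad (J̃₁ β) (Q β m) p ⟩
  ⟪ logGrad p (J̃₁ β) , logGrad p (Q β m) ⟫
    ≡⟨ ⟪⟫-linearˡ {v = logGrad p (Q β m)} (jacobian β p 0F) (λ l → logGrad p (Q β l)) (logGrad-J̃ β p 0F) ⟩
  sum3 (λ l → jacobian β p 0F l * ⟪ logGrad p (Q β l) , logGrad p (Q β m) ⟫)
    ≡⟨ sum3-cong (λ l → cong (jacobian β p 0F l *_)
         (trans (⟪⟫-cong (logGrad-Q β p p≢0 l) (logGrad-Q β p p≢0 m)) (ξQ-bracket β p p≢0 l m))) ⟩
  sum3 (λ l → jacobian β p 0F l * bracketQ q₀ q₁ q₂ l m)      ≡⟨ casimir q₀ q₁ q₂ m ⟩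
  0ℚ                                                          ∎
  where
  q₀ = eval p Q₀ ; q₁ = eval p Q₁ ; q₂ = eval p (Q₂ β)

J̃₁-J̃-bracket : ∀ β p → (∀ i → p i ≢ 0ℚ) → ∀ k → pb₀ (J̃₁ β) (J̃ β k) p ≡ 0ℚ
J̃₁-J̃-bracket β p p≢0 k = begin
  pb₀ (J̃₁ β) (J̃ β k) p                                       ≡⟨ pb₀-logGrad (J̃₁ β) (J̃ β k) p ⟩
  ⟪ logGrad p (J̃₁ β) , logGrad p (J̃ β k) ⟫
    ≡⟨ ⟪⟫-linearʳ {u = logGrad p (J̃₁ β)} (jacobian β p k) (λ l → logGrad p (Q β l)) (logGrad-J̃ β p k) ⟩
  sum3 (λ l → jacobian β p k l * ⟪ logGrad p (J̃₁ β) , logGrad p (Q β l) ⟫)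
    ≡⟨ sum3-cong (λ l → cong (jacobian β p k l *_)
         (trans (sym (pb₀-logGrad (J̃₁ β) (Q β l) p)) (J̃₁-Q-bracket β p p≢0 l))) ⟩
  sum3 (λ l → jacobian β p k l * 0ℚ)
    ≡⟨ annihilate (jacobian β p k 0F) (jacobian β p k 1F) (jacobian β p k 2F) ⟩
  0ℚ                                                          ∎
  where
  annihilate : ∀ a b c → a * 0ℚ + (b * 0ℚ + c * 0ℚ) ≡ 0ℚ
  annihilate = solve-∀ ℚ-ring

det-∂J̃∂Q : ∀ a b c → det3 (∂J̃∂Q a b c) ≡ (a - b) * (b - c) * (c - a)
det-∂J̃∂Q = vandermonde
  where
  vandermonde : ∀ a b c →
    let m₀₀ = b * c - 1ℚ ; m₀₁ = a * c - 1ℚ ; m₀₂ = a * b - 1ℚ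
        m₁₀ = b + c ; m₁₁ = a + c ; m₁₂ = a + b
        m₂₀ = b * c ; m₂₁ = a * c ; m₂₂ = a * b
    in m₀₀ * (m₁₁ * m₂₂ - m₁₂ * m₂₁) - m₀₁ * (m₁₀ * m₂₂ - m₁₂ * m₂₀) + m₀₂ * (m₁₀ * m₂₁ - m₁₁ * m₂₀)
       ≡ (a - b) * (b - c) * (c - a)
  vandermonde = solve-∀ ℚ-ring

column : Fin 3 → Fin 4
column 0F = 0F
column 1F = 3F
column 2F = 1F

logMinor : ℚ → Pt → Fin 3 → Fin 3 → ℚ
logMinor β p l j = ξQ β p l (column j)

gradients-independent-at : ∀ β p → (∀ i → p i ≢ 0ℚ) → det3 (logMinor β p) ≢ 0ℚ → det3 (jacobian β p) ≢ 0ℚ →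
  (c : Fin 3 → ℚ) → (∀ i → sum3 (λ k → c k * eval p (∂ i (J̃ β k))) ≡ 0ℚ) → ∀ k → c k ≡ 0ℚ
gradients-independent-at β p p≢0 minor≢0 jacobian≢0 c c∇J̃≡0 =
  cramer (jacobian β p) c jacobian≢0 (cramer (logMinor β p) d minor≢0 (λ j → d-annihilates (column j)))
  where
  d : Fin 3 → ℚ
  d l = sum3 (λ k → c k * jacobian β p k l)
  d-annihilates : ∀ i → sum3 (λ l → d l * ξQ β p l i) ≡ 0ℚ
  d-annihilates i = begin
    sum3 (λ l → d l * ξQ β p l i)
      ≡⟨ sum3-cong (λ l → cong (d l *_) (logGrad-Q β p p≢0 l i)) ⟨
    sum3 (λ l → d l * logGrad p (Q β l) i)
      ≡⟨ vecMat-assoc c (jacobian β p) (λ l → logGrad p (Q β l) i) ⟨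
    sum3 (λ k → c k * sum3 (λ l → jacobian β p k l * logGrad p (Q β l) i))
      ≡⟨ sum3-cong (λ k → cong (c k *_) (logGrad-J̃ β p k i)) ⟨
    sum3 (λ k → c k * logGrad p (J̃ β k) i)
      ≡⟨ factor-out (p i) (c 0F) (c 1F) (c 2F) _ _ _ ⟩
    p i * sum3 (λ k → c k * eval p (∂ i (J̃ β k)))
      ≡⟨ cong (p i *_) (c∇J̃≡0 i) ⟩
    p i * 0ℚ
      ≡⟨ *-zeroʳ (p i) ⟩
    0ℚ
      ∎
    where
    factor-out : ∀ x c₀ c₁ c₂ d₀ d₁ d₂ →
      c₀ * (x * d₀) + (c₁ * (x * d₁) + c₂ * (x * d₂)) ≡ x * (c₀ * d₀ + (c₁ * d₁ + c₂ * d₂))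
    factor-out = solve-∀ ℚ-ring

-- used for β ∈ {0, 1, -1}, where pβ has a zero coordinate or Q₀ = Q₁
p₁₂₃₅ : Pt
p₁₂₃₅ 0F = 1ℚ
p₁₂₃₅ 1F = + 2 / 1
p₁₂₃₅ 2F = + 3 / 1
p₁₂₃₅ 3F = + 5 / 1

p₁₂₃₅≢0 : ∀ i → p₁₂₃₅ i ≢ 0ℚ
p₁₂₃₅≢0 0F ()
p₁₂₃₅≢0 1F ()
p₁₂₃₅≢0 2F ()
p₁₂₃₅≢0 3F ()

-- chosen so that ∂Q₂/∂x₀ = ∂Q₂/∂x₃ = 0, which makes logMinor triangular
pβ : ℚ → Pt
pβ β 0F = 1ℚ
pβ β 1F = 1ℚ
pβ β 2F = - β
pβ β 3F = - β

module GenericPoint (β : ℚ) (β≢0 : β ≢ 0ℚ) where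

  -β≢0 : - β ≢ 0ℚ
  -β≢0 = neg-≢0 β≢0

  pβ≢0 : ∀ i → pβ β i ≢ 0ℚ
  pβ≢0 0F ()
  pβ≢0 1F ()
  pβ≢0 2F = -β≢0
  pβ≢0 3F = -β≢0

  -βι≡1 : - β * inv (- β) ≡ 1ℚ
  -βι≡1 = *-inv -β≢0

  βκ≡-1 : β * inv (1ℚ * - β) ≡ - 1ℚ
  βκ≡-1 = begin
    β * inv (1ℚ * - β)    ≡⟨ cong (λ t → β * inv t) (*-identityˡ (- β)) ⟩
    β * inv (- β)         ≡⟨ modulo (- 1ℚ) -βι≡1 (identity β (inv (- β))) ⟩
    - 1ℚ                  ∎
    where
    identity : ∀ β ι → β * ι ≡ - 1ℚ + - 1ℚ * (- β * ι - 1ℚ)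
    identity = solve-∀ ℚ-ring

  minor≢0 : det3 (logMinor β (pβ β)) ≢ 0ℚ
  minor≢0 det≡0 = diagonal≢0 (trans (sym (det3-upper (logMinor β (pβ β)) refl
                    (cong (λ t → - (1ℚ * inv 1ℚ + t)) βκ≡-1) (cong₂ (λ s t → - (s + t)) -βι≡1 βκ≡-1))) det≡0)
    where
    diagonal≢0 : 1ℚ * inv 1ℚ * (- β * inv (- β)) * (1ℚ * inv 1ℚ) ≢ 0ℚ
    diagonal≢0 = *-≢0 (*-≢0 one≢0 (*-≢0 -β≢0 (inv-≢0 -β≢0))) one≢0
      where
      one≢0 : 1ℚ * inv 1ℚ ≢ 0ℚ
      one≢0 ()

  module _ (β≢1 : β ≢ 1ℚ) (β≢-1 : β ≢ - 1ℚ) where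

    1-β≢0 : 1ℚ - β ≢ 0ℚ
    1-β≢0 e = β≢1 (sym (difference-zero e))

    1+β≢0 : 1ℚ + β ≢ 0ℚ
    1+β≢0 e = β≢-1 (difference-zero (trans (shift β) e))
      where
      shift : ∀ β → β - - 1ℚ ≡ 1ℚ + β
      shift = solve-∀ ℚ-ring

    q₀ q₁ q₂ : ℚ
    q₀ = eval (pβ β) Q₀
    q₁ = eval (pβ β) Q₁
    q₂ = eval (pβ β) (Q₂ β)

    q₂≡1 : q₂ ≡ 1ℚ
    q₂≡1 = cong₂ (λ s t → 1ℚ * inv 1ℚ + s + t) -βι≡1 βκ≡-1

    q₀-q₁≢0 : q₀ - q₁ ≢ 0ℚ
    q₀-q₁≢0 = factor-≢0 (modulo (- (1ℚ - β)) -βι≡1 (identity β (inv (- β)))) (neg-≢0 (*-≢0 1-β≢0 1+β≢0))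
      where
      identity : ∀ β ι → ((1ℚ - β) * inv 1ℚ - (1ℚ - β) * ι) * - β
                         ≡ - ((1ℚ - β) * (1ℚ + β)) + - (1ℚ - β) * (- β * ι - 1ℚ)
      identity = solve-∀ ℚ-ring

    q₁-q₂≢0 : q₁ - q₂ ≢ 0ℚ
    q₁-q₂≢0 e = inv-≢0 -β≢0 (begin
      inv (- β)          ≡⟨ modulo 1ℚ -βι≡1 (identity β (inv (- β))) ⟨
      q₁ - 1ℚ            ≡⟨ cong (λ t → q₁ - t) q₂≡1 ⟨
      q₁ - q₂            ≡⟨ e ⟩
      0ℚ                 ∎)
      where
      identity : ∀ β ι → (1ℚ - β) * ι - 1ℚ ≡ ι + 1ℚ * (- β * ι - 1ℚ)
      identity = solve-∀ ℚ-ring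

    q₂-q₀≢0 : q₂ - q₀ ≢ 0ℚ
    q₂-q₀≢0 e = β≢0 (begin
      β                  ≡⟨ identity β ⟨
      1ℚ - q₀            ≡⟨ cong (_- q₀) q₂≡1 ⟨
      q₂ - q₀            ≡⟨ e ⟩
      0ℚ                 ∎)
      where
      identity : ∀ β → 1ℚ - (1ℚ - β) * inv 1ℚ ≡ β
      identity = solve-∀ ℚ-ring

    jacobian≢0 : det3 (jacobian β (pβ β)) ≢ 0ℚ
    jacobian≢0 = subst (_≢ 0ℚ) (sym (det-∂J̃∂Q q₀ q₁ q₂)) (*-≢0 (*-≢0 q₀-q₁≢0 q₁-q₂≢0) q₂-q₀≢0)

gradients-independent : ∀ β → ∃ λ (p : Pt) → (∀ i → p i ≢ 0ℚ) ×
  ((c : Fin 3 → ℚ) → (∀ i → sum3 (λ k → c k * eval p (∂ i (J̃ β k))) ≡ 0ℚ) → ∀ k → c k ≡ 0ℚ)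
gradients-independent β with β ≟ 0ℚ | β ≟ 1ℚ | β ≟ - 1ℚ
... | yes refl | _ | _ = p₁₂₃₅ , p₁₂₃₅≢0 , gradients-independent-at 0ℚ p₁₂₃₅ p₁₂₃₅≢0 (λ ()) (λ ())
... | no _ | yes refl | _ = p₁₂₃₅ , p₁₂₃₅≢0 , gradients-independent-at 1ℚ p₁₂₃₅ p₁₂₃₅≢0 (λ ()) (λ ())
... | no _ | no _ | yes refl =
  p₁₂₃₅ , p₁₂₃₅≢0 , gradients-independent-at (- 1ℚ) p₁₂₃₅ p₁₂₃₅≢0 (λ ()) (λ ())
... | no β≢0 | no β≢1 | no β≢-1 =
  pβ β , pβ≢0 , gradients-independent-at β (pβ β) pβ≢0 minor≢0 (jacobian≢0 β≢1 β≢-1)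
  where open GenericPoint β β≢0

theorem3p9 : (β : ℚ) →
  -- (1) J̃₁, J̃₂, J̃₃ are conserved by φ (wherever p and φ(p) have nonzero coordinates)
  ((p : Pt) → (∀ i → p i ≢ 0ℚ) → (∀ i → φ β p i ≢ 0ℚ) →
    ∀ k → eval (φ β p) (J̃ β k) ≡ eval p (J̃ β k))
  -- (2) independence: at some admissible point the gradients are linearly independent
  × (∃ λ (p : Pt) → (∀ i → p i ≢ 0ℚ) ×
      ((c : Fin 3 → ℚ) →
        (∀ i → sum3 (λ k → c k * eval p (∂ i (J̃ β k))) ≡ 0ℚ) →
        ∀ k → c k ≡ 0ℚ))
  -- (3) Poisson brackets {J̃₁,J̃₂}₀ = 0 = {J̃₁,J̃₃}₀ and {J̃₁,Qⱼ}₀ = 0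
  × ((p : Pt) → (∀ i → p i ≢ 0ℚ) →
      (pb₀ (J̃₁ β) (J̃₂ β) p ≡ 0ℚ)
      × (pb₀ (J̃₁ β) (J̃₃ β) p ≡ 0ℚ)
      × (∀ j → pb₀ (J̃₁ β) (Q β j) p ≡ 0ℚ))
  -- (4) the iterates satisfy x_{n+6} − J̃₁ x_{n+3} + x_n = 0
  × ((p : Pt) → (∀ n → seq β p n ≢ 0ℚ) →
      ∀ n → seq β p (6 Data.Nat.+ n) - eval p (J̃₁ β) * seq β p (3 Data.Nat.+ n)
              + seq β p n ≡ 0ℚ)
  -- (5) explicit solution via Chebyshev polynomials
  × ((p : Pt) → (∀ n → seq β p n ≢ 0ℚ) → eval p (J̃₁ β) ≢ 0ℚ →
      ∀ n (j : Fin 3) →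
        seq β p (3 Data.Nat.* n Data.Nat.+ toℕ j)
          ≡ ((+ 2 / 1) * seq β p (toℕ j)
               - (+ 2 / 1) * seq β p (3 Data.Nat.+ toℕ j) * inv (eval p (J̃₁ β)))
              * T n (eval p (J̃₁ β) * (+ 1 / 2))
            + (- seq β p (toℕ j)
               + (+ 2 / 1) * seq β p (3 Data.Nat.+ toℕ j) * inv (eval p (J̃₁ β)))
              * U n (eval p (J̃₁ β) * (+ 1 / 2)))
theorem3p9 β =
    J̃-conserved β
  , gradients-independent β
  , (λ p p≢0 → J̃₁-J̃-bracket β p p≢0 1F , J̃₁-J̃-bracket β p p≢0 2F , J̃₁-Q-bracket β p p≢0)
  , iterates-recurrence β
  , iterates-chebyshev β
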